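{- Let $w_1,w_2,w_3$ be positive integers such that $r$ divides none of $w_2w_3$, $w_1w_3$, $w_1w_2$. Then for every integer $n\ge 0$, $$\begin{aligned} &\sum_{k+l+m=n}\binom{n}{k,l,m}S_k(dw_1-1;\chi,\xi^{w_3})\,S_l(dw_2-1;\chi,\xi^{w_1})\,S_m(dw_3-1;\chi,\xi^{w_2})\,w_3^{k}w_1^{l}w_2^{m}\\ &=\sum_{k+l+m=n}\binom{n}{k,l,m}S_k(dw_1-1;\chi,\xi^{w_2})\,S_l(dw_3-1;\chi,\xi^{w_1})\,S_m(dw_2-1;\chi,\xi^{w_3})\,w_2^{k}w_1^{l}w_3^{m}. \end{aligned}$$
   Context: Let $p$ be a prime, $\mathbb{C}_p$ the completion of an algebraic closure of $\mathbb{Q}_p$, $d$ a positive integer, and $\chi$ a primitive Dirichlet character of conductor $d$, with values viewed in $\mathbb{C}_p$ via a fixed embedding $\overline{\mathbb{Q}}\to\mathbb{C}_p$ (as usual $\chi(a)=0$ if $\gcd(a,d)>1$; for $d=1$, $\chi\equiv 1$). Let $r$ be a positive integer with $\gcd(r,pd)=1$ and let $\xi\neq 1$ in $\mathbb{C}_p$ be an $r$-th root of unity. For a root of unity $\eta\in\mathbb{C}_p$ and integers $k,m\ge 0$, the generalized twisted power sum is $S_k(m;\chi,\eta)=\sum_{a=0}^{m}\chi(a)\eta^{a}a^{k}$, with the convention $0^0=1$. Sums over $k+l+m=n$ run over all nonnegative integers $k,l,m$ with $k+l+m=n$, and $\binom{n}{k,l,m}=\frac{n!}{k!\,l!\,m!}$.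 -}

module Defs where

open import Algebra.Apartness.Bundles using (HeytingCommutativeRing; HeytingField)
open import Algebra.Bundles using (CommutativeRing; RawRing)
open import Algebra.Morphism.Structures using (IsRingHomomorphism)
import Algebra.Properties.Semiring.Exp as Exp
import Algebra.Properties.Semiring.Mult as Mult
import Algebra.Properties.Semiring.Sum as Sum
open import Data.Bool.Base using (if_then_else_)
open import Data.Fin.Base using (Fin; zero; suc; toℕ)
open import Data.Integer.Base as ℤ using (ℤ; +_; 1ℤ)
open import Data.Integer.Coprimality using (Coprime)
import Data.Integer.Divisibility as ℤ
open import Data.List.Base using (filter; length; upTo)
open import Data.Nat.Base as ℕ using (ℕ; suc; _∸_; _!; NonZero)
open import Data.Nat.Divisibility using (_∣_; _∣?_)
open import Data.Nat.Properties using (_!≢0; m*n≢0)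
open import Data.Product.Base using (∃-syntax; _×_)
open import Data.Rational.Base as ℚ using (ℚ; 0ℚ; ↥_; ↧ₙ_)
import Data.Rational.Properties as ℚ
open import Data.Vec.Functional using (Vector)
open import Function.Base using (_∘_)
open import Function.Bundles using (_⇔_)
open import Level using (Level; 0ℓ; _⊔_) renaming (suc to lsuc)
open import Relation.Binary.Construct.Add.Supremum.NonStrict ℚ._≤_ using (_≤⁺_)
open import Relation.Binary.PropositionalEquality.Core using (_≡_)
open import Relation.Nullary.Construct.Add.Supremum using (_⁺; [_]; ⊤⁺)
open import Relation.Nullary.Decidable.Core using (does)
open import Relation.Nullary.Negation.Core using (¬_)

private
  variable
    a ℓ₁ ℓ₂ b m₁ m₂ : Level

fieldRing : HeytingField a ℓ₁ ℓ₂ → CommutativeRing a ℓ₁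
fieldRing = HeytingCommutativeRing.commutativeRing ∘ HeytingField.heytingCommutativeRing

fieldRawRing : HeytingField a ℓ₁ ℓ₂ → RawRing a ℓ₁
fieldRawRing = CommutativeRing.rawRing ∘ fieldRing

ℚ-field : HeytingField 0ℓ 0ℓ 0ℓ
ℚ-field = ℚ.heytingField

-- A polynomial is given by its coefficients, constant term first.
evalPoly : (R : CommutativeRing a ℓ₁) → let open CommutativeRing R in
           ∀ {n} → Vector Carrier n → Carrier → Carrier
evalPoly R {n} c x = ∑[ i < n ] (c i * x ^ toℕ i)
  where
  open CommutativeRing R
  open Exp semiring
  open Sum semiring

IsAlgebraicallyClosed : HeytingField a ℓ₁ ℓ₂ → Set (a ⊔ ℓ₁ ⊔ ℓ₂)
IsAlgebraicallyClosed K =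
  ∀ n (c : Vector Carrier (suc n)) (i : Fin n) → c (suc i) # 0# →
  ∃[ x ] evalPoly (fieldRing K) c x ≈ 0#
  where open HeytingField K

record IsAlgebraicClosure (K : HeytingField a ℓ₁ ℓ₂) (L : HeytingField b m₁ m₂)
         (φ : HeytingField.Carrier K → HeytingField.Carrier L)
         : Set (a ⊔ ℓ₁ ⊔ ℓ₂ ⊔ b ⊔ m₁ ⊔ m₂) where
  private
    module K = HeytingField K
    module L = HeytingField L
  field
    isRingHomomorphism : IsRingHomomorphism (fieldRawRing K) (fieldRawRing L) φ
    algebraic          : ∀ (x : L.Carrier) →
                         ∃[ n ] ∃[ c ] ((∃[ i ] c i K.# K.0#) ×
                           evalPoly (fieldRing L) {n} (φ ∘ c) x L.≈ L.0#)
    closed             : IsAlgebraicallyClosed L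

-- Absolute values are written additively: |x| = p^(- v x), with v x = ∞
-- for x = 0.  On ℂ_p and its subfields v takes values in ℚ ∪ {∞}.

ℚ∞ : Set
ℚ∞ = ℚ ⁺

infixl 6 _+∞_

_+∞_ : ℚ∞ → ℚ∞ → ℚ∞
[ x ] +∞ [ y ] = [ x ℚ.+ y ]
[ _ ] +∞ ⊤⁺    = ⊤⁺
⊤⁺    +∞ _     = ⊤⁺

record IsValuation (K : HeytingField a ℓ₁ ℓ₂) (v : HeytingField.Carrier K → ℚ∞)
         : Set (a ⊔ ℓ₁) where
  open HeytingField K
  field
    cong        : ∀ {x y} → x ≈ y → v x ≡ v y
    ∞⇔0         : ∀ x → v x ≡ ⊤⁺ ⇔ x ≈ 0#
    mult        : ∀ x y → v (x * y) ≡ v x +∞ v y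
    ultrametric : ∀ x y q → q ≤⁺ v x → q ≤⁺ v y → q ≤⁺ v (x + y)

record IsComplete (K : HeytingField a ℓ₁ ℓ₂) (v : HeytingField.Carrier K → ℚ∞)
         : Set a where
  open HeytingField K

  IsCauchy : (ℕ → Carrier) → Set
  IsCauchy s = ∀ (q : ℚ) → ∃[ N ] (∀ i j → N ℕ.≤ i → N ℕ.≤ j → [ q ] ≤⁺ v (s i - s j))

  _ConvergesTo_ : (ℕ → Carrier) → Carrier → Set
  s ConvergesTo x = ∀ (q : ℚ) → ∃[ N ] (∀ i → N ℕ.≤ i → [ q ] ≤⁺ v (s i - x))

  field
    limit : ∀ s → IsCauchy s → ∃[ x ] s ConvergesTo x

record IsCompletion (K : HeytingField a ℓ₁ ℓ₂) (v : HeytingField.Carrier K → ℚ∞)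
         (L : HeytingField b m₁ m₂) (w : HeytingField.Carrier L → ℚ∞)
         (φ : HeytingField.Carrier K → HeytingField.Carrier L)
         : Set (a ⊔ ℓ₁ ⊔ b ⊔ m₁) where
  private
    module L = HeytingField L
  field
    isRingHomomorphism : IsRingHomomorphism (fieldRawRing K) (fieldRawRing L) φ
    isValuation        : IsValuation L w
    extends            : ∀ x → w (φ x) ≡ v x
    dense              : ∀ (y : L.Carrier) (q : ℚ) → ∃[ x ] [ q ] ≤⁺ w (y L.- φ x)
    complete           : IsComplete L w

-- For p ≥ 2 and n ≥ 1 the exponents e ≥ 1 with p ^ e ∣ n all satisfy e ≤ n,
-- so counting them gives the multiplicity of p in n.
multiplicity : ℕ → ℕ → ℕ
multiplicity p n = length (filter (λ e → p ℕ.^ suc e ∣? n) (upTo n))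

padicValuation : ℕ → ℚ → ℚ∞
padicValuation p q =
  if does (q ℚ.≟ 0ℚ) then ⊤⁺
  else [ (+ multiplicity p ℤ.∣ ↥ q ∣ ℤ.- + multiplicity p (↧ₙ q)) ℚ./ 1 ]

-- The constructions of ℚ_p, of its algebraic closure and of ℂ_p are not
-- carried out; instead a value of this type is any field ℂₚ presented as
-- the completion of an algebraic closure of the completion of ℚ at p.
-- These properties determine ℂₚ up to isomorphism.  Since the valuations
-- are ℚ∞-valued functions, they make equality decidable, as it is classically.
record PadicComplexNumbers (p : ℕ) a ℓ₁ ℓ₂ : Set (lsuc (a ⊔ ℓ₁ ⊔ ℓ₂)) where
  field
    ℚₚ ℚ̄ₚ ℂₚ : HeytingField a ℓ₁ ℓ₂

  private
    module ℚₚ = HeytingField ℚₚ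
    module ℚ̄ₚ = HeytingField ℚ̄ₚ
    module ℂₚ = HeytingField ℂₚ

  field
    v : ℚₚ.Carrier → ℚ∞
    v̄ : ℚ̄ₚ.Carrier → ℚ∞
    w : ℂₚ.Carrier → ℚ∞

    ℚ→ℚₚ  : ℚ → ℚₚ.Carrier
    ℚₚ→ℚ̄ₚ : ℚₚ.Carrier → ℚ̄ₚ.Carrier
    ℚ̄ₚ→ℂₚ : ℚ̄ₚ.Carrier → ℂₚ.Carrier

    ℚₚ-isCompletion       : IsCompletion ℚ-field (padicValuation p) ℚₚ v ℚ→ℚₚ
    ℚ̄ₚ-isAlgebraicClosure : IsAlgebraicClosure ℚₚ ℚ̄ₚ ℚₚ→ℚ̄ₚ
    v̄-isValuation         : IsValuation ℚ̄ₚ v̄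
    v̄-extends             : ∀ x → v̄ (ℚₚ→ℚ̄ₚ x) ≡ v x
    ℂₚ-isCompletion       : IsCompletion ℚ̄ₚ v̄ ℂₚ w ℚ̄ₚ→ℂₚ

-- A character modulo d is extended by zero to a function on ℤ.
module _ (R : CommutativeRing a ℓ₁) where
  open CommutativeRing R

  record IsDirichletCharacter (d : ℕ) (χ : ℤ → Carrier) : Set (a ⊔ ℓ₁) where
    field
      periodic   : ∀ i j → + d ℤ.∣ i ℤ.- j → χ i ≈ χ j
      mult       : ∀ i j → χ (i ℤ.* j) ≈ χ i * χ j
      unit       : χ 1ℤ ≈ 1#
      nonCoprime : ∀ i → ¬ Coprime i (+ d) → χ i ≈ 0#

  record IsPrimitiveDirichletCharacter (d : ℕ) (χ : ℤ → Carrier) : Set (a ⊔ ℓ₁) where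
    field
      isDirichletCharacter : IsDirichletCharacter d χ
      notInduced           : ∀ e → e ∣ d → ∀ ψ → IsDirichletCharacter e ψ →
                             (∀ i → Coprime i (+ d) → χ i ≈ ψ i) → e ≡ d

multinomial : ℕ → ℕ → ℕ → ℕ → ℕ
multinomial n k l m = (n !) ℕ./ (k ! ℕ.* l ! ℕ.* m !)
  where
  instance
    k!≢0 : NonZero (k !)
    k!≢0 = k !≢0
    l!≢0 : NonZero (l !)
    l!≢0 = l !≢0
    m!≢0 : NonZero (m !)
    m!≢0 = m !≢0
    k!l!≢0 : NonZero (k ! ℕ.* l !)
    k!l!≢0 = m*n≢0 (k !) (l !)
    k!l!m!≢0 : NonZero (k ! ℕ.* l ! ℕ.* m !)
    k!l!m!≢0 = m*n≢0 (k ! ℕ.* l !) (m !)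

module TwistedPowerSums (R : CommutativeRing a ℓ₁) where
  open CommutativeRing R public using (Carrier; _≈_; _*_; 1#)
  open Exp (CommutativeRing.semiring R) public using (_^_)
  open Mult (CommutativeRing.semiring R) public using () renaming (_×_ to _·_)
  open Sum (CommutativeRing.semiring R)

  fromℕ : ℕ → Carrier
  fromℕ n = n · 1#

  -- x ^ 0 is 1# for every x, so the term i = 0 follows the convention 0⁰ = 1.
  S : ℕ → ℕ → (ℤ → Carrier) → Carrier → Carrier
  S k m χ η = ∑[ i ≤ m ] (χ (+ toℕ i) * η ^ toℕ i * fromℕ (toℕ i) ^ k)

  -- The sum of f k l m over all k, l, m with k + l + m = n.
  ∑₃ : ℕ → (ℕ → ℕ → ℕ → Carrier) → Carrier
  ∑₃ n f = ∑[ k ≤ n ] ∑[ l ≤ n ∸ toℕ k ] f (toℕ k) (toℕ l) (n ∸ toℕ k ∸ toℕ l)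

{-# OPTIONS --safe #-}

-- Let T n s send f : ℕ → ℂₚ to x ↦ ∑_{i < d n} χ(i) f(i s + x).  By the
-- binomial theorem, applied twice, the left-hand side is the value at 0 of
-- T w₁ w₃ (T w₂ w₁ (T w₃ w₂ f)) for f(x) = ξˣ xⁿ, and the right-hand side is that
-- of T w₁ w₂ (T w₃ w₁ (T w₂ w₃ f)).  All operators of this shape commute, and so
-- does the difference Δ s f x = f(s + x) − f(x).  As χ has period d, telescoping
-- gives T n s ∘ Δ (d s) = U s ∘ Δ (d n s), where U s f x is the
-- same sum over i < d.  Hence the two triple products agree after composition
-- with Δ (d w₁) ∘ Δ (d w₂) ∘ Δ (d w₃), and this is surjective.
module Submission where

open import Defs
open import Algebra.Apartness.Bundles using (HeytingField)
open import Algebra.Bundles using (CommutativeMonoid; CommutativeRing)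
open import Algebra.Morphism.Structures using (IsRingMonomorphism)
import Algebra.Properties.AbelianGroup as AbelianGroup
import Algebra.Properties.CommutativeSemigroup as CommutativeSemigroup
import Algebra.Properties.CommutativeSemiring.Binomial as Binomial
import Algebra.Properties.CommutativeSemiring.Exp as CommutativeExp
import Algebra.Properties.Ring as RingProperties
import Algebra.Properties.Semiring.Exp as Exp
import Algebra.Properties.Semiring.Mult as Mult
import Algebra.Properties.Semiring.Sum as Sum
open import Data.Fin.Base using (Fin; toℕ)
open import Data.Fin.Properties using (toℕ≤pred[n])
open import Data.Integer.Base as ℤ using (ℤ; +_)
import Data.Integer.Divisibility as ℤ
import Data.Integer.Properties as ℤ
open import Data.List.Base using (List; []; _∷_; [_]; _++_)
import Data.List.Properties as List
open import Data.Nat.Base as ℕ using (ℕ; zero; suc; _∸_; _!; _≤_; _/_; _%_; NonZero)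
open import Data.Nat.Combinatorics using (_C_; nCk≡n!/k![n-k]!; k![n∸k]!∣n!)
open import Data.Nat.Divisibility using (_∣_; ∣-refl)
open import Data.Nat.DivMod
  using (m*n/n≡m; m/n*n≡m; n/n≡1; m≡m%n+[m/n]*n; +-distrib-/-∣ˡ; %-remove-+ˡ; /-congˡ)
open import Data.Nat.GCD using (gcd)
open import Data.Nat.Primality using (Prime)
import Data.Nat.Properties as ℕ
open import Data.Product.Base using (∃-syntax; _,_)
open import Data.Rational.Base using (ℚ)
open import Function.Base using (_∘_)
open import Level using (Level; _⊔_)
open import Relation.Binary.PropositionalEquality.Core as ≡ using (_≡_)
open import Relation.Binary.PropositionalEquality.Properties using (module ≡-Reasoning)
import Relation.Binary.Reasoning.Setoid as SetoidReasoning
open import Relation.Nullary.Negation.Core using (¬_)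

private
  variable
    a ℓ : Level

-- Multinomial coefficients as products of binomial coefficients.

nCk*k![n∸k]!≡n! : ∀ {n k} → k ≤ n → (n C k) ℕ.* (k ! ℕ.* (n ∸ k) !) ≡ n !
nCk*k![n∸k]!≡n! {n} {k} k≤n =
  ≡.trans (≡.cong (ℕ._* (k ! ℕ.* (n ∸ k) !)) (nCk≡n!/k![n-k]! k≤n)) (m/n*n≡m (k![n∸k]!∣n! k≤n))
  where instance _ = k ℕ.!* (n ∸ k) !≢0

-- Factoring n! as (n C k) k! (n - k)! and then (n - k)! in the same way exhibits the denominator as
-- a factor of n!, so the truncating division in `multinomial` is exact.
multinomial≡C*C : ∀ {n k l} → k ≤ n → l ≤ n ∸ k →
                  multinomial n k l (n ∸ k ∸ l) ≡ (n C k) ℕ.* ((n ∸ k) C l)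
multinomial≡C*C {n} {k} {l} k≤n l≤n∸k =
  ≡.trans (/-congˡ {o = k ! ℕ.* l ! ℕ.* m !} n!≡) (m*n/n≡m (c ℕ.* c′) (k ! ℕ.* l ! ℕ.* m !))
  where
  open ≡-Reasoning
  m = n ∸ k ∸ l
  c = n C k
  c′ = (n ∸ k) C l
  instance
    k!l!≢0 = k ℕ.!* l !≢0
    k!l!m!≢0 = ℕ.m*n≢0 (k ! ℕ.* l !) (m !) {{k!l!≢0}} {{m ℕ.!≢0}}
  n!≡ : n ! ≡ c ℕ.* c′ ℕ.* (k ! ℕ.* l ! ℕ.* m !)
  n!≡ = begin
    n !                                    ≡⟨ nCk*k![n∸k]!≡n! k≤n ⟨
    c ℕ.* (k ! ℕ.* (n ∸ k) !)              ≡⟨ ≡.cong (λ z → c ℕ.* (k ! ℕ.* z)) (nCk*k![n∸k]!≡n! l≤n∸k) ⟨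
    c ℕ.* (k ! ℕ.* (c′ ℕ.* (l ! ℕ.* m !))) ≡⟨ ≡.cong (c ℕ.*_) (x∙yz≈y∙xz (k !) c′ _) ⟩
    c ℕ.* (c′ ℕ.* (k ! ℕ.* (l ! ℕ.* m !))) ≡⟨ ℕ.*-assoc c c′ _ ⟨
    c ℕ.* c′ ℕ.* (k ! ℕ.* (l ! ℕ.* m !))   ≡⟨ ≡.cong (c ℕ.* c′ ℕ.*_) (ℕ.*-assoc (k !) (l !) (m !)) ⟨
    c ℕ.* c′ ℕ.* (k ! ℕ.* l ! ℕ.* m !)     ∎
    where open CommutativeSemigroup ℕ.*-commutativeSemigroup using (x∙yz≈y∙xz)

-- Weighted sums of shifts as operators on sequences.

module ShiftOperators (R : CommutativeRing a ℓ) where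
  open CommutativeRing R
  open AbelianGroup +-abelianGroup using () renaming (∙-cancelʳ to +-cancelʳ)
  open RingProperties ring using (-1*x≈-x)
  open Sum semiring
  open SetoidReasoning setoid
  private
    module + = CommutativeSemigroup +-commutativeSemigroup
    module * = CommutativeSemigroup *-commutativeSemigroup
    module ℕ+ = CommutativeSemigroup ℕ.+-commutativeSemigroup

  ∑-split : ∀ m n (f : ℕ → Carrier) →
            ∑[ i < m ℕ.+ n ] f (toℕ i) ≈ ∑[ i < m ] f (toℕ i) + ∑[ i < n ] f (m ℕ.+ toℕ i)
  ∑-split zero    n f = sym (+-identityˡ _)
  ∑-split (suc m) n f = trans (+-congˡ (∑-split m n (f ∘ suc))) (sym (+-assoc _ _ _))

  ∑-minus : ∀ {n} (f g : Fin n → Carrier) → ∑[ i < n ] (f i - g i) + ∑[ i < n ] g i ≈ ∑[ i < n ] f i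
  ∑-minus f g = trans (sym (∑-distrib-+ _ g)) (sum-cong-≋ λ i →
    trans (+-assoc _ _ _) (trans (+-congˡ (-‿inverseˡ (g i))) (+-identityʳ (f i))))

  -- Adding the sums of `f` over i < m and over i < n to either side turns it into the sum of `f`
  -- over i < m + n.
  ∑-telescope : ∀ m n (f : ℕ → Carrier) →
                ∑[ i < m ] (f (n ℕ.+ toℕ i) - f (toℕ i)) ≈ ∑[ i < n ] (f (m ℕ.+ toℕ i) - f (toℕ i))
  ∑-telescope m n f = +-cancelʳ (F m + F n) _ _ (begin
    ∑[ i < m ] (f (n ℕ.+ toℕ i) - f (toℕ i)) + (F m + F n)  ≈⟨ +-assoc _ _ _ ⟨
    ∑[ i < m ] (f (n ℕ.+ toℕ i) - f (toℕ i)) + F m + F n    ≈⟨ +-congʳ (∑-minus {m} _ _) ⟩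
    ∑[ i < m ] f (n ℕ.+ toℕ i) + F n                        ≈⟨ +-comm _ _ ⟩
    F n + ∑[ i < m ] f (n ℕ.+ toℕ i)                        ≈⟨ ∑-split n m f ⟨
    F (n ℕ.+ m)                                             ≡⟨ ≡.cong F (ℕ.+-comm n m) ⟩
    F (m ℕ.+ n)                                             ≈⟨ ∑-split m n f ⟩
    F m + ∑[ i < n ] f (m ℕ.+ toℕ i)                        ≈⟨ +-congˡ (∑-minus {n} _ _) ⟨
    F m + (∑[ i < n ] (f (m ℕ.+ toℕ i) - f (toℕ i)) + F n)  ≈⟨ +.x∙yz≈y∙xz _ _ _ ⟩
    ∑[ i < n ] (f (m ℕ.+ toℕ i) - f (toℕ i)) + (F m + F n)  ∎)
    where
    F : ℕ → Carrier
    F k = ∑[ i < k ] f (toℕ i)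

  -- A weight defined on all of ℕ can serve sums of different lengths and be compared with itself at
  -- shifted indices.
  record ShiftSum : Set a where
    constructor shiftSum
    field
      weight : ℕ → Carrier
      terms  : ℕ
      step   : ℕ

  apply : ShiftSum → (ℕ → Carrier) → ℕ → Carrier
  apply (shiftSum c n s) f x = ∑[ i < n ] (c (toℕ i) * f (toℕ i ℕ.* s ℕ.+ x))

  apply-cong : ∀ t {f g} → (∀ x → f x ≈ g x) → ∀ x → apply t f x ≈ apply t g x
  apply-cong (shiftSum c n s) f≈g x = sum-cong-≋ {n} λ i → *-congˡ (f≈g _)

  apply-linear : ∀ t {m} (c : Fin m → Carrier) (f : Fin m → ℕ → Carrier) x →
                 apply t (λ y → ∑[ k < m ] (c k * f k y)) x ≈ ∑[ k < m ] (c k * apply t (f k) x)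
  apply-linear (shiftSum b n s) {m} c f x = begin
    ∑[ i < n ] (b (toℕ i) * ∑[ k < m ] (c k * f k (y i)))
      ≈⟨ sum-cong-≋ {n} (λ i → *-distribˡ-sum (b (toℕ i)) (λ k → c k * f k (y i))) ⟩
    ∑[ i < n ] ∑[ k < m ] (b (toℕ i) * (c k * f k (y i)))
      ≈⟨ ∑-comm {n} {m} (λ i k → b (toℕ i) * (c k * f k (y i))) ⟩
    ∑[ k < m ] ∑[ i < n ] (b (toℕ i) * (c k * f k (y i)))
      ≈⟨ sum-cong-≋ {m} (λ k → sum-cong-≋ {n} λ i → *.x∙yz≈y∙xz _ _ _) ⟩
    ∑[ k < m ] ∑[ i < n ] (c k * (b (toℕ i) * f k (y i)))
      ≈⟨ sum-cong-≋ {m} (λ k → *-distribˡ-sum (c k) (λ i → b (toℕ i) * f k (y i))) ⟨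
    ∑[ k < m ] (c k * ∑[ i < n ] (b (toℕ i) * f k (y i))) ∎
    where
    y : Fin n → ℕ
    y i = toℕ i ℕ.* s ℕ.+ x

  -- `apply u f` is itself a linear combination of translates of `f`, so linearity moves `t` inside
  -- that sum; what remains is that two translations may be made in either order.
  apply-comm : ∀ t u f x → apply t (apply u f) x ≈ apply u (apply t f) x
  apply-comm t@(shiftSum b m r) u@(shiftSum c n s) f x = begin
    apply t (apply u f) x
      ≈⟨ apply-linear t {n} (c ∘ toℕ) (λ k y → f (toℕ k ℕ.* s ℕ.+ y)) x ⟩
    ∑[ k < n ] (c (toℕ k) * ∑[ i < m ] (b (toℕ i) * f (toℕ k ℕ.* s ℕ.+ (toℕ i ℕ.* r ℕ.+ x))))
      ≈⟨ sum-cong-≋ {n} (λ k → *-congˡ (sum-cong-≋ {m} λ i → *-congˡ (reflexive (≡.cong f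
           (ℕ+.x∙yz≈y∙xz (toℕ k ℕ.* s) (toℕ i ℕ.* r) x))))) ⟩
    apply u (apply t f) x ∎

  -- Composites of shift sums as a commutative monoid.

  ⟦_⟧ : List ShiftSum → (ℕ → Carrier) → ℕ → Carrier
  ⟦ [] ⟧     f = f
  ⟦ t ∷ ts ⟧ f = apply t (⟦ ts ⟧ f)

  infix 4 _≋_

  -- A record rather than a bare function type, so that unification can recover `ts` and `us` from
  -- an equivalence between them.
  record _≋_ (ts us : List ShiftSum) : Set (a ⊔ ℓ) where
    constructor pointwise
    field
      at : ∀ f x → ⟦ ts ⟧ f x ≈ ⟦ us ⟧ f x

  open _≋_ public

  ⟦⟧-cong : ∀ ts {f g} → (∀ x → f x ≈ g x) → ∀ x → ⟦ ts ⟧ f x ≈ ⟦ ts ⟧ g x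
  ⟦⟧-cong []       f≈g = f≈g
  ⟦⟧-cong (t ∷ ts) f≈g = apply-cong t (⟦⟧-cong ts f≈g)

  ⟦⟧-++ : ∀ ts us f x → ⟦ ts ++ us ⟧ f x ≈ ⟦ ts ⟧ (⟦ us ⟧ f) x
  ⟦⟧-++ []       us f x = refl
  ⟦⟧-++ (t ∷ ts) us f   = apply-cong t (⟦⟧-++ ts us f)

  apply-⟦⟧ : ∀ t us f x → apply t (⟦ us ⟧ f) x ≈ ⟦ us ⟧ (apply t f) x
  apply-⟦⟧ t []       f x = refl
  apply-⟦⟧ t (u ∷ us) f x =
    trans (apply-comm t u (⟦ us ⟧ f) x) (apply-cong u (apply-⟦⟧ t us f) x)

  ⟦⟧-comm : ∀ ts us f x → ⟦ ts ⟧ (⟦ us ⟧ f) x ≈ ⟦ us ⟧ (⟦ ts ⟧ f) x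
  ⟦⟧-comm []       us f x = refl
  ⟦⟧-comm (t ∷ ts) us f x =
    trans (apply-cong t (⟦⟧-comm ts us f) x) (apply-⟦⟧ t us (⟦ ts ⟧ f) x)

  ≋-reflexive : ∀ {ts us} → ts ≡ us → ts ≋ us
  ≋-reflexive ≡.refl = pointwise λ f x → refl

  -- With commutation of operators in this bundled form, factors of a composite can be rearranged by
  -- the generic lemmas on commutative semigroups.
  ++-commutativeMonoid : CommutativeMonoid _ _
  ++-commutativeMonoid = record
    { Carrier = List ShiftSum
    ; _≈_     = _≋_
    ; _∙_     = _++_
    ; ε       = []
    ; isCommutativeMonoid = record
      { isMonoid = record
        { isSemigroup = record
          { isMagma = record
            { isEquivalence = record
              { refl  = pointwise λ f x → refl
              ; sym   = λ p → pointwise λ f x → sym (at p f x)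
              ; trans = λ p q → pointwise λ f x → trans (at p f x) (at q f x)
              }
            ; ∙-cong = λ {ts} {ts′} {us} {us′} p q → pointwise λ f x → begin
                ⟦ ts ++ us ⟧ f x      ≈⟨ ⟦⟧-++ ts us f x ⟩
                ⟦ ts ⟧ (⟦ us ⟧ f) x   ≈⟨ at p _ x ⟩
                ⟦ ts′ ⟧ (⟦ us ⟧ f) x  ≈⟨ ⟦⟧-cong ts′ (at q f) x ⟩
                ⟦ ts′ ⟧ (⟦ us′ ⟧ f) x ≈⟨ ⟦⟧-++ ts′ us′ f x ⟨
                ⟦ ts′ ++ us′ ⟧ f x    ∎
            }
          ; assoc = λ ts us vs → ≋-reflexive (List.++-assoc ts us vs)
          }
        ; identity = (λ ts → ≋-reflexive ≡.refl) , (λ ts → ≋-reflexive (List.++-identityʳ ts))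
        }
      ; comm = λ ts us → pointwise λ f x →
          trans (⟦⟧-++ ts us f x) (trans (⟦⟧-comm ts us f x) (sym (⟦⟧-++ us ts f x)))
      }
    }

  -- Encoded as a shift sum, with weight -1 at shift 0 and weight 1 at shift s, so that differences
  -- commute with all other operators by `apply-comm`.
  Δ : ℕ → ShiftSum
  Δ = shiftSum (λ { zero → - 1# ; (suc _) → 1# }) 2

  apply-Δ : ∀ s f x → apply (Δ s) f x ≈ f (s ℕ.+ x) - f x
  apply-Δ s f x = begin
    - 1# * f x + (1# * f (s ℕ.+ 0 ℕ.+ x) + 0#)  ≈⟨ +-comm _ _ ⟩
    1# * f (s ℕ.+ 0 ℕ.+ x) + 0# + - 1# * f x
      ≈⟨ +-cong (trans (+-identityʳ _) (*-identityˡ _)) (-1*x≈-x (f x)) ⟩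
    f (s ℕ.+ 0 ℕ.+ x) - f x  ≡⟨ ≡.cong (λ z → f (z ℕ.+ x) - f x) (ℕ.+-identityʳ s) ⟩
    f (s ℕ.+ x) - f x        ∎

  -- The preimage `F` sums `f` over those points of the residue class of x modulo s that lie below
  -- x. Passing from x to s + x adds exactly the point x.
  Δ-surjective : ∀ s .{{_ : NonZero s}} (f : ℕ → Carrier) → ∃[ F ] (∀ x → apply (Δ s) F x ≈ f x)
  Δ-surjective s f = F , λ x → begin
    apply (Δ s) F x      ≈⟨ apply-Δ s F x ⟩
    F (s ℕ.+ x) - F x    ≈⟨ +-congʳ (F-shift x) ⟩
    f x + F x - F x      ≈⟨ +-assoc _ _ _ ⟩
    f x + (F x - F x)    ≈⟨ +-congˡ (-‿inverseʳ (F x)) ⟩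
    f x + 0#             ≈⟨ +-identityʳ (f x) ⟩
    f x                  ∎
    where
    G : ℕ → ℕ → Carrier
    G q r = ∑[ i < q ] f (r ℕ.+ toℕ i ℕ.* s)
    F : ℕ → Carrier
    F x = G (x / s) (x % s)
    [s+x]/s : ∀ x → (s ℕ.+ x) / s ≡ x / s ℕ.+ 1
    [s+x]/s x = ≡.trans (+-distrib-/-∣ˡ x (∣-refl {s}))
                  (≡.trans (≡.cong (ℕ._+ x / s) (n/n≡1 s)) (ℕ.+-comm 1 (x / s)))
    F-shift : ∀ x → F (s ℕ.+ x) ≈ f x + F x
    F-shift x = begin
      F (s ℕ.+ x)                                    ≡⟨ ≡.cong₂ G ([s+x]/s x) (%-remove-+ˡ x (∣-refl {s})) ⟩
      G (q ℕ.+ 1) r                                  ≈⟨ ∑-split q 1 (λ i → f (r ℕ.+ i ℕ.* s)) ⟩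
      F x + (f (r ℕ.+ (q ℕ.+ 0) ℕ.* s) + 0#)         ≈⟨ +-congˡ (+-identityʳ _) ⟩
      F x + f (r ℕ.+ (q ℕ.+ 0) ℕ.* s)
        ≡⟨ ≡.cong (λ z → F x + f (r ℕ.+ z ℕ.* s)) (ℕ.+-identityʳ q) ⟩
      F x + f (r ℕ.+ q ℕ.* s)                        ≡⟨ ≡.cong (λ z → F x + f z) (m≡m%n+[m/n]*n x s) ⟨
      F x + f x                                      ≈⟨ +-comm _ _ ⟩
      f x + F x                                      ∎
      where
      q = x / s
      r = x % s

  -- The last entry of a list acts first, and every sequence is a value of `Δ s`; hence agreement on
  -- all such values is agreement everywhere.
  ++-cancelʳ-Δ : ∀ s .{{_ : NonZero s}} ts us → ts ++ [ Δ s ] ≋ us ++ [ Δ s ] → ts ≋ us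
  ++-cancelʳ-Δ s ts us p = pointwise λ f x → let (F , ΔF≈f) = Δ-surjective s f in begin
    ⟦ ts ⟧ f x             ≈⟨ ⟦⟧-cong ts ΔF≈f x ⟨
    ⟦ ts ⟧ (⟦ D ⟧ F) x     ≈⟨ ⟦⟧-++ ts D F x ⟨
    ⟦ ts ++ D ⟧ F x        ≈⟨ at p F x ⟩
    ⟦ us ++ D ⟧ F x        ≈⟨ ⟦⟧-++ us D F x ⟩
    ⟦ us ⟧ (⟦ D ⟧ F) x     ≈⟨ ⟦⟧-cong us ΔF≈f x ⟩
    ⟦ us ⟧ f x             ∎
    where D = [ Δ s ]

  ++-cancelʳ-Δ³ : ∀ r s t .{{_ : NonZero r}} .{{_ : NonZero s}} .{{_ : NonZero t}} ts us →
                  ts ++ Δ r ∷ Δ s ∷ Δ t ∷ [] ≋ us ++ Δ r ∷ Δ s ∷ Δ t ∷ [] → ts ≋ us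
  ++-cancelʳ-Δ³ r s t ts us p =
    ++-cancelʳ-Δ r _ _ (++-cancelʳ-Δ s _ _ (++-cancelʳ-Δ t _ _
      (≡.subst₂ _≋_ (reassoc ts) (reassoc us) p)))
    where
    reassoc : ∀ ts → ts ++ Δ r ∷ Δ s ∷ Δ t ∷ [] ≡ ((ts ++ [ Δ r ]) ++ [ Δ s ]) ++ [ Δ t ]
    reassoc ts = ≡.sym (≡.trans (List.++-assoc (ts ++ [ Δ r ]) [ Δ s ] [ Δ t ])
                                (List.++-assoc ts [ Δ r ] (Δ s ∷ Δ t ∷ [])))

  -- Periodic weights and the symmetry of the triple product.

  module Periodic (d : ℕ) .{{_ : NonZero d}} (c : ℕ → Carrier)
                  (periodic : ∀ i → c (d ℕ.+ i) ≈ c i) where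

    T : ℕ → ℕ → ShiftSum
    T n = shiftSum c (d ℕ.* n)

    U : ℕ → ShiftSum
    U = shiftSum c d

    periodic* : ∀ n i → c (d ℕ.* n ℕ.+ i) ≈ c i
    periodic* zero    i = reflexive (≡.cong (λ z → c (z ℕ.+ i)) (ℕ.*-zeroʳ d))
    periodic* (suc n) i = begin
      c (d ℕ.* suc n ℕ.+ i)      ≡⟨ ≡.cong (λ z → c (z ℕ.+ i)) (ℕ.*-suc d n) ⟩
      c (d ℕ.+ d ℕ.* n ℕ.+ i)    ≡⟨ ≡.cong c (ℕ.+-assoc d (d ℕ.* n) i) ⟩
      c (d ℕ.+ (d ℕ.* n ℕ.+ i))  ≈⟨ periodic _ ⟩
      c (d ℕ.* n ℕ.+ i)          ≈⟨ periodic* n i ⟩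
      c i                        ∎

    -- Translation by k s moves term i to position k + i, and since k is a period of `c` the weight
    -- can move with it. Each summand is thus an increment of one sequence in i, ready for
    -- telescoping.
    apply-shiftSum-Δ : ∀ m k → (∀ i → c (k ℕ.+ i) ≈ c i) → ∀ s f x →
      apply (shiftSum c m s) (apply (Δ (k ℕ.* s)) f) x ≈
      ∑[ i < m ] (c (k ℕ.+ toℕ i) * f ((k ℕ.+ toℕ i) ℕ.* s ℕ.+ x) - c (toℕ i) * f (toℕ i ℕ.* s ℕ.+ x))
    apply-shiftSum-Δ m k k-periodic s f x = sum-cong-≋ {m} λ j → term (toℕ j)
      where
      term : ∀ i → c i * apply (Δ (k ℕ.* s)) f (i ℕ.* s ℕ.+ x) ≈
                   c (k ℕ.+ i) * f ((k ℕ.+ i) ℕ.* s ℕ.+ x) - c i * f (i ℕ.* s ℕ.+ x)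
      term i = begin
        c i * apply (Δ (k ℕ.* s)) f y             ≈⟨ *-congˡ (apply-Δ (k ℕ.* s) f y) ⟩
        c i * (f (k ℕ.* s ℕ.+ y) - f y)           ≈⟨ distribˡ _ _ _ ⟩
        c i * f (k ℕ.* s ℕ.+ y) + c i * - f y
          ≈⟨ +-cong (*-cong (sym (k-periodic i)) (reflexive (≡.cong f ks+y))) (sym (-‿distribʳ-* _ _)) ⟩
        c (k ℕ.+ i) * f ((k ℕ.+ i) ℕ.* s ℕ.+ x) - c i * f y ∎
        where
        open RingProperties ring using (-‿distribʳ-*)
        y = i ℕ.* s ℕ.+ x
        ks+y : k ℕ.* s ℕ.+ y ≡ (k ℕ.+ i) ℕ.* s ℕ.+ x
        ks+y = ≡.trans (≡.sym (ℕ.+-assoc (k ℕ.* s) (i ℕ.* s) x))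
                       (≡.cong (ℕ._+ x) (≡.sym (ℕ.*-distribʳ-+ s k i)))

    -- In terms of `g`, the left side adds d n increments of length d and the right side d
    -- increments of length d n; `∑-telescope` exchanges the two.
    T-Δ : ∀ n s → T n s ∷ Δ (d ℕ.* s) ∷ [] ≋ U s ∷ Δ (d ℕ.* n ℕ.* s) ∷ []
    T-Δ n s = pointwise λ f x → let g = λ i → c i * f (i ℕ.* s ℕ.+ x) in begin
      apply (T n s) (apply (Δ (d ℕ.* s)) f) x  ≈⟨ apply-shiftSum-Δ (d ℕ.* n) d periodic s f x ⟩
      ∑[ i < d ℕ.* n ] (g (d ℕ.+ toℕ i) - g (toℕ i))  ≈⟨ ∑-telescope (d ℕ.* n) d g ⟩
      ∑[ i < d ] (g (d ℕ.* n ℕ.+ toℕ i) - g (toℕ i))  ≈⟨ apply-shiftSum-Δ d (d ℕ.* n) (periodic* n) s f x ⟨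
      apply (U s) (apply (Δ (d ℕ.* n ℕ.* s)) f) x  ∎

    -- Both products use the steps w₂, w₁, w₃ once each. Composed with `Δ (d s)` for each step s,
    -- either one becomes the composite of the same three one-period sums with the differences of
    -- steps d wᵢ wⱼ, one for each pair of distinct indices.
    T³-symmetric : ∀ w₁ w₂ w₃ .{{_ : NonZero w₁}} .{{_ : NonZero w₂}} .{{_ : NonZero w₃}} →
                   T w₃ w₂ ∷ T w₂ w₁ ∷ T w₁ w₃ ∷ [] ≋ T w₂ w₃ ∷ T w₃ w₁ ∷ T w₁ w₂ ∷ []
    T³-symmetric w₁ w₂ w₃ =
      ++-cancelʳ-Δ³ (d ℕ.* w₂) (d ℕ.* w₁) (d ℕ.* w₃) _ _ (M.begin
        L ++ D                       M.≈⟨ L³-Δ³ w₃ w₂ w₁ w₂ w₁ w₃ ⟩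
        V ++ E₃₂ ++ E₂₁ ++ E₁₃       M.≈⟨ ∙-congˡ {V} (x∙yz≈y∙zx E₃₂ E₂₁ E₁₃) ⟩
        V ++ E₂₁ ++ E₁₃ ++ E₃₂
          -- `E n s` depends only on the product of n and s, so the arguments may be swapped in all
          -- three factors.
          M.≡⟨ ≡.cong (V ++_) (≡.cong₂ _++_ (E-comm w₂ w₁) (≡.cong₂ _++_ (E-comm w₁ w₃) (E-comm w₃ w₂))) ⟩
        V ++ E w₁ w₂ ++ E w₃ w₁ ++ E w₂ w₃
          -- `D` lists the differences in the order w₂, w₁, w₃, so the right-hand product is first
          -- met with its steps in this order and reversed afterwards.
          M.≈⟨ L³-Δ³ w₁ w₃ w₂ w₂ w₁ w₃ ⟨
        (T w₁ w₂ ∷ T w₃ w₁ ∷ T w₂ w₃ ∷ []) ++ D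
          M.≈⟨ ∙-congʳ {D} (x∙yz≈z∙yx [ T w₁ w₂ ] [ T w₃ w₁ ] [ T w₂ w₃ ]) ⟩
        (T w₂ w₃ ∷ T w₃ w₁ ∷ T w₁ w₂ ∷ []) ++ D  M.∎)
      where
      open CommutativeMonoid ++-commutativeMonoid using (∙-cong; ∙-congˡ; ∙-congʳ; commutativeSemigroup)
      open CommutativeSemigroup commutativeSemigroup using (x∙yz≈y∙zx; x∙yz≈z∙yx; interchange)
      module M = SetoidReasoning (CommutativeMonoid.setoid ++-commutativeMonoid)
      instance
        _ = ℕ.m*n≢0 d w₁
        _ = ℕ.m*n≢0 d w₂
        _ = ℕ.m*n≢0 d w₃
      E : ℕ → ℕ → List ShiftSum
      E n s = [ Δ (d ℕ.* n ℕ.* s) ]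
      E-comm : ∀ n s → E n s ≡ E s n
      E-comm n s = ≡.cong (λ z → [ Δ z ])
        (≡.trans (ℕ.*-assoc d n s) (≡.trans (≡.cong (d ℕ.*_) (ℕ.*-comm n s)) (≡.sym (ℕ.*-assoc d s n))))
      L = T w₃ w₂ ∷ T w₂ w₁ ∷ T w₁ w₃ ∷ []
      D = Δ (d ℕ.* w₂) ∷ Δ (d ℕ.* w₁) ∷ Δ (d ℕ.* w₃) ∷ []
      V = U w₂ ∷ U w₁ ∷ U w₃ ∷ []
      E₃₂ = E w₃ w₂
      E₂₁ = E w₂ w₁
      E₁₃ = E w₁ w₃
      interchange³ : ∀ r s t r′ s′ t′ →
        (r ++ s ++ t) ++ (r′ ++ s′ ++ t′) ≋ (r ++ r′) ++ (s ++ s′) ++ (t ++ t′)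
      interchange³ r s t r′ s′ t′ = M.begin
        (r ++ s ++ t) ++ (r′ ++ s′ ++ t′)     M.≈⟨ interchange r (s ++ t) r′ (s′ ++ t′) ⟩
        (r ++ r′) ++ (s ++ t) ++ (s′ ++ t′)   M.≈⟨ ∙-congˡ {r ++ r′} (interchange s t s′ t′) ⟩
        (r ++ r′) ++ (s ++ s′) ++ (t ++ t′)   M.∎
      -- Regrouping puts next to each `T` the difference of its own step, which is what `T-Δ`
      -- consumes.
      L³-Δ³ : ∀ l m n r s t →
        (T l r ∷ T m s ∷ T n t ∷ []) ++ (Δ (d ℕ.* r) ∷ Δ (d ℕ.* s) ∷ Δ (d ℕ.* t) ∷ []) ≋
        (U r ∷ U s ∷ U t ∷ []) ++ E l r ++ E m s ++ E n t
      L³-Δ³ l m n r s t = M.begin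
        (T l r ∷ T m s ∷ T n t ∷ []) ++ (Δ (d ℕ.* r) ∷ Δ (d ℕ.* s) ∷ Δ (d ℕ.* t) ∷ [])
          M.≈⟨ interchange³ [ T l r ] [ T m s ] [ T n t ] [ Δ (d ℕ.* r) ] [ Δ (d ℕ.* s) ] [ Δ (d ℕ.* t) ] ⟩
        (T l r ∷ Δ (d ℕ.* r) ∷ []) ++ (T m s ∷ Δ (d ℕ.* s) ∷ []) ++ (T n t ∷ Δ (d ℕ.* t) ∷ [])
          M.≈⟨ ∙-cong (T-Δ l r) (∙-cong (T-Δ m s) (T-Δ n t)) ⟩
        ([ U r ] ++ E l r) ++ ([ U s ] ++ E m s) ++ ([ U t ] ++ E n t)
          M.≈⟨ interchange³ [ U r ] [ U s ] [ U t ] (E l r) (E m s) (E n t) ⟨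
        (U r ∷ U s ∷ U t ∷ []) ++ E l r ++ E m s ++ E n t M.∎

-- Expansion of operator products on x ↦ ξˣ xⁿ.

module Expansion (R : CommutativeRing a ℓ) (ξ : CommutativeRing.Carrier R) where
  open CommutativeRing R
  open TwistedPowerSums R using (_^_; _·_; fromℕ; S; ∑₃)
  open Exp semiring using (^-congˡ; ^-homo-*; ^-assocʳ)
  open CommutativeExp commutativeSemiring using (^-distrib-*)
  open Mult semiring
    using (×-congʳ; ×-congˡ; ×-comm-*; ×-assoc-*; ×-assocˡ; ×-homo-+; ×1-homo-*)
  open Sum semiring
  open ShiftOperators R
  open SetoidReasoning setoid
  private module * = CommutativeSemigroup *-commutativeSemigroup

  -- Formally the coefficient of tⁿ / n! in (ξ eᵗ)ˣ, whose multiplicativity in x is the source of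
  -- `expPower-+`.
  expPower : ℕ → ℕ → Carrier
  expPower n x = ξ ^ x * fromℕ x ^ n

  -- The value at 0 of the operator on `expPower k`; by `S*power≈moment` it is also a twisted power
  -- sum times a power of the step.
  moment : ShiftSum → ℕ → Carrier
  moment (shiftSum c m s) k = ∑[ i < m ] (c (toℕ i) * expPower k (toℕ i ℕ.* s))

  apply-expPower-0 : ∀ t n → apply t (expPower n) 0 ≈ moment t n
  apply-expPower-0 (shiftSum c m s) n = sum-cong-≋ {m} λ i →
    *-congˡ (reflexive (≡.cong (expPower n) (ℕ.+-identityʳ (toℕ i ℕ.* s))))

  -- The exponent law splits ξ and the binomial theorem splits the power. The binomial coefficient
  -- stays with the factor in y, so that the factor in x can later be summed into a `moment`.
  expPower-+ : ∀ n x y → expPower n (x ℕ.+ y) ≈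
               ∑[ k ≤ n ] (expPower (toℕ k) x * ((n C toℕ k) · expPower (n ∸ toℕ k) y))
  expPower-+ n x y = begin
    ξ ^ (x ℕ.+ y) * fromℕ (x ℕ.+ y) ^ n
      ≈⟨ *-cong (^-homo-* ξ x y) (^-congˡ n (×-homo-+ 1# x y)) ⟩
    ξ ^ x * ξ ^ y * (fromℕ x + fromℕ y) ^ n
      ≈⟨ *-congˡ (Binomial.theorem commutativeSemiring n (fromℕ x) (fromℕ y)) ⟩
    ξ ^ x * ξ ^ y * ∑[ k ≤ n ] ((n C toℕ k) · (fromℕ x ^ toℕ k * fromℕ y ^ (n ∸ toℕ k)))
      ≈⟨ *-distribˡ-sum _ (λ (k : Fin (suc n)) → (n C toℕ k) · (fromℕ x ^ toℕ k * fromℕ y ^ (n ∸ toℕ k))) ⟩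
    ∑[ k ≤ n ] (ξ ^ x * ξ ^ y * ((n C toℕ k) · (fromℕ x ^ toℕ k * fromℕ y ^ (n ∸ toℕ k))))
      ≈⟨ sum-cong-≋ {suc n} (λ k → term (toℕ k)) ⟩
    ∑[ k ≤ n ] (expPower (toℕ k) x * ((n C toℕ k) · expPower (n ∸ toℕ k) y)) ∎
    where
    term : ∀ k → ξ ^ x * ξ ^ y * ((n C k) · (fromℕ x ^ k * fromℕ y ^ (n ∸ k))) ≈
                 expPower k x * ((n C k) · expPower (n ∸ k) y)
    term k = begin
      ξ ^ x * ξ ^ y * ((n C k) · (fromℕ x ^ k * fromℕ y ^ (n ∸ k)))   ≈⟨ ×-comm-* (n C k) _ _ ⟩
      (n C k) · (ξ ^ x * ξ ^ y * (fromℕ x ^ k * fromℕ y ^ (n ∸ k)))   ≈⟨ ×-congʳ (n C k) (*.interchange _ _ _ _) ⟩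
      (n C k) · (expPower k x * expPower (n ∸ k) y)                   ≈⟨ ×-comm-* (n C k) _ _ ⟨
      expPower k x * ((n C k) · expPower (n ∸ k) y)                   ∎

  apply-expPower : ∀ t n x → apply t (expPower n) x ≈
                   ∑[ k ≤ n ] (((n C toℕ k) · moment t (toℕ k)) * expPower (n ∸ toℕ k) x)
  apply-expPower t@(shiftSum c m s) n x = begin
    ∑[ i < m ] (c (toℕ i) * expPower n (toℕ i ℕ.* s ℕ.+ x))
      ≈⟨ sum-cong-≋ {m} (λ i → trans (*-congˡ (expPower-+ n (toℕ i ℕ.* s) x))
           (trans (*-distribˡ-sum (c (toℕ i)) (λ k → A i k * B k))
                  (sum-cong-≋ {suc n} λ k → sym (*-assoc (c (toℕ i)) (A i k) (B k))))) ⟩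
    ∑[ i < m ] ∑[ k ≤ n ] (c (toℕ i) * A i k * B k)
      ≈⟨ ∑-comm {m} {suc n} (λ i k → c (toℕ i) * A i k * B k) ⟩
    ∑[ k ≤ n ] ∑[ i < m ] (c (toℕ i) * A i k * B k)
      ≈⟨ sum-cong-≋ {suc n} (λ k → *-distribʳ-sum (B k) (λ i → c (toℕ i) * A i k)) ⟨
    ∑[ k ≤ n ] (moment t (toℕ k) * B k)
      ≈⟨ sum-cong-≋ {suc n} (λ k → trans (×-comm-* (n C toℕ k) (moment t (toℕ k)) (expPower (n ∸ toℕ k) x))
           (sym (×-assoc-* (n C toℕ k) (moment t (toℕ k)) (expPower (n ∸ toℕ k) x)))) ⟩
    ∑[ k ≤ n ] (((n C toℕ k) · moment t (toℕ k)) * expPower (n ∸ toℕ k) x) ∎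
    where
    A : Fin m → Fin (suc n) → Carrier
    A i k = expPower (toℕ k) (toℕ i ℕ.* s)
    B : Fin (suc n) → Carrier
    B k = (n C toℕ k) · expPower (n ∸ toℕ k) x

  apply-apply-expPower : ∀ t u n x → apply t (apply u (expPower n)) x ≈
    ∑[ k ≤ n ] (((n C toℕ k) · moment u (toℕ k)) * apply t (expPower (n ∸ toℕ k)) x)
  apply-apply-expPower t u n x = trans (apply-cong t (apply-expPower u n) x)
    (apply-linear t {suc n} (λ k → (n C toℕ k) · moment u (toℕ k)) (λ k → expPower (n ∸ toℕ k)) x)

  -- The innermost operator `t` acts first and produces the index k, then `u` produces l. The last
  -- operator is evaluated at 0, where it contributes only its moment of the remaining order m.
  ⟦⟧-expPower : ∀ t u v n → ⟦ v ∷ u ∷ t ∷ [] ⟧ (expPower n) 0 ≈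
    ∑₃ n (λ k l m → multinomial n k l m · (moment t k * moment u l * moment v m))
  ⟦⟧-expPower t u v n = begin
    apply v (apply u (apply t (expPower n))) 0
      ≈⟨ apply-cong v (apply-apply-expPower u t n) 0 ⟩
    apply v (λ y → ∑[ k ≤ n ] (α k * apply u (expPower (n ∸ toℕ k)) y)) 0
      ≈⟨ apply-linear v {suc n} α (λ k → apply u (expPower (n ∸ toℕ k))) 0 ⟩
    ∑[ k ≤ n ] (α k * apply v (apply u (expPower (n ∸ toℕ k))) 0)
      ≈⟨ sum-cong-≋ {suc n} (λ k → trans (*-congˡ (apply-apply-expPower v u (n ∸ toℕ k) 0))
           (*-distribˡ-sum (α k) (λ (l : Fin (suc (n ∸ toℕ k))) → β k l * γ k l))) ⟩
    ∑[ k ≤ n ] ∑[ l ≤ n ∸ toℕ k ] (α k * (β k l * γ k l))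
      ≈⟨ sum-cong-≋ {suc n} (λ k → sum-cong-≋ {suc (n ∸ toℕ k)} λ l →
           -- The summation bounds give k ≤ n and l ≤ n - k, the hypotheses of `multinomial≡C*C`.
           term (toℕ≤pred[n] k) (toℕ≤pred[n] l)) ⟩
    ∑₃ n (λ k l m → multinomial n k l m · (moment t k * moment u l * moment v m)) ∎
    where
    α : Fin (suc n) → Carrier
    α k = (n C toℕ k) · moment t (toℕ k)
    β γ : (k : Fin (suc n)) → Fin (suc (n ∸ toℕ k)) → Carrier
    β k l = ((n ∸ toℕ k) C toℕ l) · moment u (toℕ l)
    γ k l = apply v (expPower (n ∸ toℕ k ∸ toℕ l)) 0
    term : ∀ {k l} → k ≤ n → l ≤ n ∸ k →
      ((n C k) · moment t k) * ((((n ∸ k) C l) · moment u l) * apply v (expPower (n ∸ k ∸ l)) 0) ≈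
      multinomial n k l (n ∸ k ∸ l) · (moment t k * moment u l * moment v (n ∸ k ∸ l))
    term {k} {l} k≤n l≤n∸k = begin
      (c · x) * ((c′ · y) * apply v (expPower m) 0)
        ≈⟨ *-congˡ (*-congˡ (apply-expPower-0 v m)) ⟩
      (c · x) * ((c′ · y) * z)     ≈⟨ ×-assoc-* c x _ ⟩
      c · (x * ((c′ · y) * z))     ≈⟨ ×-congʳ c (trans (*-congˡ (×-assoc-* c′ y z)) (×-comm-* c′ x _)) ⟩
      c · (c′ · (x * (y * z)))     ≈⟨ ×-assocˡ _ c c′ ⟩
      (c ℕ.* c′) · (x * (y * z))   ≈⟨ ×-congʳ (c ℕ.* c′) (*-assoc x y z) ⟨
      (c ℕ.* c′) · (x * y * z)     ≈⟨ ×-congˡ (multinomial≡C*C k≤n l≤n∸k) ⟨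
      multinomial n k l m · (x * y * z) ∎
      where
      m = n ∸ k ∸ l
      c = n C k
      c′ = (n ∸ k) C l
      x = moment t k
      y = moment u l
      z = moment v m

  -- The power of s is absorbed termwise: (ξˢ)ⁱ iᵏ sᵏ = ξⁱˢ (i s)ᵏ. As `S` includes its upper bound,
  -- the bound m - 1 gives exactly m terms for m nonzero.
  S*power≈moment : ∀ k m .{{_ : NonZero m}} (χ : ℤ → Carrier) s →
    S k (m ∸ 1) χ (ξ ^ s) * fromℕ s ^ k ≈ moment (shiftSum (χ ∘ +_) m s) k
  S*power≈moment k m@(suc m-1) χ s = begin
    S k m-1 χ (ξ ^ s) * fromℕ s ^ k
      ≈⟨ *-distribʳ-sum (fromℕ s ^ k) (λ (i : Fin m) → χ (+ toℕ i) * (ξ ^ s) ^ toℕ i * fromℕ (toℕ i) ^ k) ⟩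
    ∑[ i < m ] (χ (+ toℕ i) * (ξ ^ s) ^ toℕ i * fromℕ (toℕ i) ^ k * fromℕ s ^ k)
      ≈⟨ sum-cong-≋ {m} (λ i → term (toℕ i)) ⟩
    moment (shiftSum (χ ∘ +_) m s) k ∎
    where
    term : ∀ i → χ (+ i) * (ξ ^ s) ^ i * fromℕ i ^ k * fromℕ s ^ k ≈ χ (+ i) * expPower k (i ℕ.* s)
    term i = begin
      χ (+ i) * (ξ ^ s) ^ i * fromℕ i ^ k * fromℕ s ^ k    ≈⟨ *-assoc _ _ _ ⟩
      χ (+ i) * (ξ ^ s) ^ i * (fromℕ i ^ k * fromℕ s ^ k)  ≈⟨ *-assoc _ _ _ ⟩
      χ (+ i) * ((ξ ^ s) ^ i * (fromℕ i ^ k * fromℕ s ^ k))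
        ≈⟨ *-congˡ (*-cong (trans (^-assocʳ ξ s i) (reflexive (≡.cong (ξ ^_) (ℕ.*-comm s i))))
                           (trans (sym (^-distrib-* _ _ k)) (^-congˡ k (sym (×1-homo-* i s))))) ⟩
      χ (+ i) * expPower k (i ℕ.* s)                       ∎

  -- Each power sum is paired with the power of its own twist exponent, and the pair is a moment.
  -- The list is reversed because the first index belongs to the innermost operator.
  ∑₃-S≈⟦⟧ : ∀ m₁ m₂ m₃ .{{_ : NonZero m₁}} .{{_ : NonZero m₂}} .{{_ : NonZero m₃}}
            (χ : ℤ → Carrier) s₁ s₂ s₃ n →
    ∑₃ n (λ k l m → multinomial n k l m ·
      (S k (m₁ ∸ 1) χ (ξ ^ s₁) * S l (m₂ ∸ 1) χ (ξ ^ s₂) * S m (m₃ ∸ 1) χ (ξ ^ s₃)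
        * (fromℕ s₁ ^ k * fromℕ s₂ ^ l * fromℕ s₃ ^ m)))
    ≈ ⟦ shiftSum (χ ∘ +_) m₃ s₃ ∷ shiftSum (χ ∘ +_) m₂ s₂ ∷ shiftSum (χ ∘ +_) m₁ s₁ ∷ [] ⟧ (expPower n) 0
  ∑₃-S≈⟦⟧ m₁ m₂ m₃ χ s₁ s₂ s₃ n = trans
    (sum-cong-≋ {suc n} λ k → sum-cong-≋ {suc (n ∸ toℕ k)} λ l →
      ×-congʳ (multinomial n (toℕ k) (toℕ l) (n ∸ toℕ k ∸ toℕ l)) (term (toℕ k) (toℕ l) (n ∸ toℕ k ∸ toℕ l)))
    (sym (⟦⟧-expPower (t m₁ s₁) (t m₂ s₂) (t m₃ s₃) n))
    where
    t : ℕ → ℕ → ShiftSum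
    t = shiftSum (χ ∘ +_)
    term : ∀ k l m →
      S k (m₁ ∸ 1) χ (ξ ^ s₁) * S l (m₂ ∸ 1) χ (ξ ^ s₂) * S m (m₃ ∸ 1) χ (ξ ^ s₃)
        * (fromℕ s₁ ^ k * fromℕ s₂ ^ l * fromℕ s₃ ^ m)
      ≈ moment (t m₁ s₁) k * moment (t m₂ s₂) l * moment (t m₃ s₃) m
    term k l m = trans (*.interchange _ _ _ _) (*-cong
      (trans (*.interchange _ _ _ _) (*-cong (S*power≈moment k m₁ χ s₁) (S*power≈moment l m₂ χ s₂)))
      (S*power≈moment m m₃ χ s₃))

-- The symmetry for power sums twisted by a Dirichlet character.

theorem11 :
  ∀ {a ℓ₁ ℓ₂ b m₁ m₂}
    (p : ℕ) → Prime p →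
    (padic : PadicComplexNumbers p a ℓ₁ ℓ₂) →
    let open PadicComplexNumbers padic using (ℂₚ)
        open TwistedPowerSums (fieldRing ℂₚ) in
    (ℚ̄ : HeytingField b m₁ m₂) (ℚ→ℚ̄ : ℚ → HeytingField.Carrier ℚ̄) →
    IsAlgebraicClosure ℚ-field ℚ̄ ℚ→ℚ̄ →
    (ι : HeytingField.Carrier ℚ̄ → Carrier) →
    IsRingMonomorphism (fieldRawRing ℚ̄) (fieldRawRing ℂₚ) ι →
    (d : ℕ) → .{{NonZero d}} →
    (χ₀ : ℤ → HeytingField.Carrier ℚ̄) →
    IsPrimitiveDirichletCharacter (fieldRing ℚ̄) d χ₀ →
    (r : ℕ) → .{{NonZero r}} → gcd r (p ℕ.* d) ≡ 1 →
    (ξ : Carrier) → ξ ^ r ≈ 1# → ¬ (ξ ≈ 1#) →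
    (w₁ w₂ w₃ : ℕ) → .{{NonZero w₁}} → .{{NonZero w₂}} → .{{NonZero w₃}} →
    ¬ (r ∣ w₂ ℕ.* w₃) → ¬ (r ∣ w₁ ℕ.* w₃) → ¬ (r ∣ w₁ ℕ.* w₂) →
    (n : ℕ) →
    let χ = ι ∘ χ₀ in
    ∑₃ n (λ k l m → multinomial n k l m ·
      (S k (d ℕ.* w₁ ∸ 1) χ (ξ ^ w₃)
        * S l (d ℕ.* w₂ ∸ 1) χ (ξ ^ w₁)
        * S m (d ℕ.* w₃ ∸ 1) χ (ξ ^ w₂)
        * (fromℕ w₃ ^ k * fromℕ w₁ ^ l * fromℕ w₂ ^ m)))
    ≈
    ∑₃ n (λ k l m → multinomial n k l m ·
      (S k (d ℕ.* w₁ ∸ 1) χ (ξ ^ w₂)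
        * S l (d ℕ.* w₃ ∸ 1) χ (ξ ^ w₁)
        * S m (d ℕ.* w₂ ∸ 1) χ (ξ ^ w₃)
        * (fromℕ w₂ ^ k * fromℕ w₁ ^ l * fromℕ w₃ ^ m)))
theorem11 p _ padic ℚ̄ ℚ→ℚ̄ _ ι ι-mono d χ₀ χ₀-primitive r _ ξ _ _ w₁ w₂ w₃ _ _ _ n = begin
  _  ≈⟨ ∑₃-S≈⟦⟧ (d ℕ.* w₁) (d ℕ.* w₂) (d ℕ.* w₃) χ w₃ w₁ w₂ n ⟩
  -- Both sides are now triple products of operators applied to x ↦ ξˣ xⁿ and evaluated at 0.
  _  ≈⟨ at (T³-symmetric w₁ w₂ w₃) (expPower n) 0 ⟩
  _  ≈⟨ ∑₃-S≈⟦⟧ (d ℕ.* w₁) (d ℕ.* w₃) (d ℕ.* w₂) χ w₂ w₁ w₃ n ⟨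
  _  ∎
  where
  R = fieldRing (PadicComplexNumbers.ℂₚ padic)
  χ = ι ∘ χ₀
  open CommutativeRing R using (_≈_; setoid)
  open SetoidReasoning setoid
  open IsRingMonomorphism ι-mono using (⟦⟧-cong)
  open IsPrimitiveDirichletCharacter χ₀-primitive using (isDirichletCharacter)
  open Expansion R ξ using (∑₃-S≈⟦⟧; expPower)
  instance
    _ = ℕ.m*n≢0 d w₁
    _ = ℕ.m*n≢0 d w₂
    _ = ℕ.m*n≢0 d w₃
  [d+i]-i≡d : ∀ i → + (d ℕ.+ i) ℤ.- + i ≡ + d
  [d+i]-i≡d i = ≡.trans (ℤ.+-assoc (+ d) (+ i) (ℤ.- + i))
    (≡.trans (≡.cong (λ z → + d ℤ.+ z) (ℤ.+-inverseʳ (+ i))) (ℤ.+-identityʳ (+ d)))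
  periodic : ∀ i → χ (+ (d ℕ.+ i)) ≈ χ (+ i)
  periodic i = ⟦⟧-cong (IsDirichletCharacter.periodic isDirichletCharacter (+ (d ℕ.+ i)) (+ i)
    -- Integer divisibility unfolds to divisibility of absolute values, so reflexivity on ℕ
    -- suffices.
    (≡.subst (λ z → + d ℤ.∣ z) (≡.sym ([d+i]-i≡d i)) ∣-refl))
  open ShiftOperators R using (at)
  open ShiftOperators.Periodic R d (χ ∘ +_) periodic using (T³-symmetric)
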